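{- Let $a,b,c$ be nonzero real numbers, and let $\{u_n\}$ and $\{v_n\}$ be the generalized bi-periodic Fibonacci and Lucas sequences. For any nonnegative integers $n,r$ and $m$ with $m>1$, $$u_{mn+r}=\frac{a^{1-\zeta(mn+r)}}{(ab)^{\lfloor \frac{mn+r}{2}\rfloor}}\sum_{i=0}^{n}\binom{n}{i}c^{\,n-i}u_m^{\,i}u_{m-1}^{\,n-i}u_{i+r}\,\delta[m,n,r,i],$$ $$v_{mn+r}=\frac{a^{1-\zeta(mn+r)}}{(ab)^{\lfloor \frac{mn+r}{2}\rfloor}}\sum_{i=0}^{n}\binom{n}{i}c^{\,n-i}u_m^{\,i}u_{m-1}^{\,n-i}v_{i+r}\,\delta[m,n,r,i],$$ where $$\delta[m,n,r,i]:=(ab)^{\lfloor \frac{i+r}{2}\rfloor+n\lfloor \frac m2\rfloor}\,a^{ -\zeta(m+1)i-1+\zeta(i+r)}\,b^{\zeta(m)(n-i)}.$$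
   Context: For nonzero real numbers $a,b,c$, let $\chi(n)=a$ if $n$ is even and $\chi(n)=b$ if $n$ is odd. The generalized bi-periodic Fibonacci sequence $\{u_n\}$ is defined by $u_0=0$, $u_1=1$, $u_n=\chi(n)u_{n-1}+c\,u_{n-2}$ for $n\ge2$; the generalized bi-periodic Lucas sequence $\{v_n\}$ is defined by $v_0=2$, $v_1=b$ and $v_n=\chi(n)v_{n-1}+c\,v_{n-2}$ for $n\ge 2$. The parity function is $\zeta(n)=0$ if $n$ is even and $\zeta(n)=1$ if $n$ is odd. The convention $x^0=1$ (including $x=0$) is used. -}

module Defs where

open import Algebra.Bundles using (CommutativeRing)
import Algebra.Properties.Semiring.Exp as SemiringExp
import Algebra.Properties.Semiring.Mult as SemiringMult
import Algebra.Properties.Semiring.Sum as SemiringSum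
open import Algebra.Structures using (IsCommutativeRing)
open import Data.Empty using (⊥-elim)
open import Data.Fin.Base using (toℕ)
open import Data.Integer.Base as ℤ using (ℤ; +_; -[1+_]; 1ℤ)
open import Data.Nat.Base as ℕ using (ℕ; zero; suc; ⌊_/2⌋; parity)
import Data.Nat.Properties as ℕ
open import Data.Parity.Base using (0ℙ; 1ℙ)
open import Data.Product.Base using (∃; _×_; _,_)
open import Data.Rational.Base as ℚ using (ℚ; 0ℚ; 1ℚ; ∣_∣)
import Data.Rational.Properties as ℚ
open import Data.Rational.Solver using (module +-*-Solver)
open import Level using (0ℓ)
open import Relation.Binary.PropositionalEquality.Core
  using (_≡_; _≢_; refl; sym; trans; cong; cong₂; subst; subst₂)
open import Relation.Binary.Structures using (IsEquivalence)
open import Relation.Nullary.Decidable.Core using (yes; no)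

private
  0<1 : 0ℚ ℚ.< 1ℚ
  0<1 = ℚ.positive⁻¹ 1ℚ

  0<+ : ∀ {p q} → 0ℚ ℚ.< p → 0ℚ ℚ.< q → 0ℚ ℚ.< p ℚ.+ q
  0<+ = ℚ.+-mono-<

  0<* : ∀ {p q} → 0ℚ ℚ.< p → 0ℚ ℚ.< q → 0ℚ ℚ.< p ℚ.* q
  0<* {p} {q} 0<p 0<q = ℚ.positive⁻¹ (p ℚ.* q)
    {{ℚ.pos*pos⇒pos p {{ℚ.positive 0<p}} q {{ℚ.positive 0<q}}}}

  0<⇒≢0 : ∀ {p} → 0ℚ ℚ.< p → p ≢ 0ℚ
  0<⇒≢0 0<p refl = ℚ.<-irrefl refl 0<p

  -- The inverse of p, with the value 0 at p = 0.
  recip : ℚ → ℚ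
  recip p with p ℚ.≟ 0ℚ
  ... | yes _   = 0ℚ
  ... | no  p≢0 = ℚ.1/_ p {{ℚ.≢-nonZero p≢0}}

  recip-inverse : ∀ p → p ≢ 0ℚ → p ℚ.* recip p ≡ 1ℚ
  recip-inverse p p≢0 with p ℚ.≟ 0ℚ
  ... | yes p≡0 = ⊥-elim (p≢0 p≡0)
  ... | no  p≢0 = ℚ.*-inverseʳ p {{ℚ.≢-nonZero p≢0}}

  recip-pos : ∀ {p} → 0ℚ ℚ.< p → 0ℚ ℚ.< recip p
  recip-pos {p} 0<p with p ℚ.≟ 0ℚ
  ... | yes p≡0 = ⊥-elim (0<⇒≢0 0<p p≡0)
  ... | no  p≢0 = ℚ.positive⁻¹ (ℚ.1/_ p {{ℚ.≢-nonZero p≢0}})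
    {{ℚ.1/pos⇒pos p {{ℚ.positive 0<p}}}}

  divide : ∀ {b ε} → 0ℚ ℚ.< b → 0ℚ ℚ.< ε →
           ∃ λ δ → 0ℚ ℚ.< δ × b ℚ.* δ ≡ ε
  divide {b} {ε} 0<b 0<ε =
    recip b ℚ.* ε , 0<* (recip-pos 0<b) 0<ε ,
    trans (sym (ℚ.*-assoc b (recip b) ε))
      (trans (cong (ℚ._* ε) (recip-inverse b (0<⇒≢0 0<b)))
        (ℚ.*-identityˡ ε))

  halve : ∀ {ε} → 0ℚ ℚ.< ε → ∃ λ δ → 0ℚ ℚ.< δ × δ ℚ.+ δ ≡ ε
  halve 0<ε with divide (0<+ 0<1 0<1) 0<ε
  ... | δ , 0<δ , eq = δ , 0<δ ,
    trans (solve 1 (λ δ → δ :+ δ := (con 1ℚ :+ con 1ℚ) :* δ) refl δ) eq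
    where open +-*-Solver

  ∣p-q∣≡∣q-p∣ : ∀ p q → ∣ p ℚ.- q ∣ ≡ ∣ q ℚ.- p ∣
  ∣p-q∣≡∣q-p∣ p q = trans
    (cong ∣_∣ (solve 2 (λ p q → p :- q := :- (q :- p)) refl p q))
    (ℚ.∣-p∣≡∣p∣ (q ℚ.- p))
    where open +-*-Solver

  *-mono-≤-< : ∀ {p q r s} → 0ℚ ℚ.≤ r → 0ℚ ℚ.< q →
               p ℚ.≤ q → r ℚ.< s → p ℚ.* r ℚ.< q ℚ.* s
  *-mono-≤-< {p} {q} {r} {s} 0≤r 0<q p≤q r<s = ℚ.≤-<-trans
    (ℚ.*-monoʳ-≤-nonNeg r {{ℚ.nonNegative 0≤r}} p≤q)
    (ℚ.*-monoʳ-<-pos q {{ℚ.positive 0<q}} r<s)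

  triangle : ∀ p q r {δ ε} → ∣ p ℚ.- q ∣ ℚ.< δ → ∣ q ℚ.- r ∣ ℚ.< ε →
             ∣ p ℚ.- r ∣ ℚ.< δ ℚ.+ ε
  triangle p q r pq qr = ℚ.≤-<-trans
    (subst (λ t → ∣ t ∣ ℚ.≤ ∣ p ℚ.- q ∣ ℚ.+ ∣ q ℚ.- r ∣)
      (solve 3 (λ p q r → (p :- q) :+ (q :- r) := p :- r) refl p q r)
      (ℚ.∣p+q∣≤∣p∣+∣q∣ (p ℚ.- q) (q ℚ.- r)))
    (ℚ.+-mono-< pq qr)
    where open +-*-Solver

  +-close : ∀ p p′ q q′ {δ ε} → ∣ p ℚ.- p′ ∣ ℚ.< δ → ∣ q ℚ.- q′ ∣ ℚ.< ε →
            ∣ (p ℚ.+ q) ℚ.- (p′ ℚ.+ q′) ∣ ℚ.< δ ℚ.+ ε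
  +-close p p′ q q′ pp qq = ℚ.≤-<-trans
    (subst (λ t → ∣ t ∣ ℚ.≤ ∣ p ℚ.- p′ ∣ ℚ.+ ∣ q ℚ.- q′ ∣)
      (solve 4 (λ p p′ q q′ →
        (p :- p′) :+ (q :- q′) := (p :+ q) :- (p′ :+ q′)) refl p p′ q q′)
      (ℚ.∣p+q∣≤∣p∣+∣q∣ (p ℚ.- p′) (q ℚ.- q′)))
    (ℚ.+-mono-< pp qq)
    where open +-*-Solver

  neg-close : ∀ p p′ {ε} → ∣ p ℚ.- p′ ∣ ℚ.< ε →
              ∣ (ℚ.- p) ℚ.- (ℚ.- p′) ∣ ℚ.< ε
  neg-close p p′ {ε} = subst (ℚ._< ε) (trans (∣p-q∣≡∣q-p∣ p p′)
    (cong ∣_∣ (solve 2 (λ p p′ → p′ :- p := (:- p) :- (:- p′)) refl p p′)))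
    where open +-*-Solver

  *-close : ∀ p p′ q q′ {A B δ} → 0ℚ ℚ.< A → 0ℚ ℚ.< B →
            ∣ p ∣ ℚ.≤ A → ∣ q′ ∣ ℚ.≤ B →
            ∣ p ℚ.- p′ ∣ ℚ.< δ → ∣ q ℚ.- q′ ∣ ℚ.< δ →
            ∣ p ℚ.* q ℚ.- p′ ℚ.* q′ ∣ ℚ.< (A ℚ.+ B) ℚ.* δ
  *-close p p′ q q′ {A} {B} {δ} 0<A 0<B p≤A q′≤B pp qq =
    subst₂ (λ s t → ∣ s ∣ ℚ.< t)
      (solve 4 (λ p p′ q q′ →
        p :* (q :- q′) :+ q′ :* (p :- p′) := p :* q :- p′ :* q′) refl p p′ q q′)
      (sym (ℚ.*-distribʳ-+ δ A B))
      (ℚ.≤-<-trans (ℚ.∣p+q∣≤∣p∣+∣q∣ (p ℚ.* (q ℚ.- q′)) (q′ ℚ.* (p ℚ.- p′)))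
        (ℚ.+-mono-<
          (subst (ℚ._< A ℚ.* δ) (sym (ℚ.∣p*q∣≡∣p∣*∣q∣ p (q ℚ.- q′)))
            (*-mono-≤-< (ℚ.0≤∣p∣ (q ℚ.- q′)) 0<A p≤A qq))
          (subst (ℚ._< B ℚ.* δ) (sym (ℚ.∣p*q∣≡∣p∣*∣q∣ q′ (p ℚ.- p′)))
            (*-mono-≤-< (ℚ.0≤∣p∣ (p ℚ.- p′)) 0<B q′≤B pp))))
    where open +-*-Solver

  <-by : ∀ {p q r} → q ≡ r → p ℚ.< q → p ℚ.< r
  <-by refl p<q = p<q

  ∣∣-bound : ∀ p q → ∣ p ℚ.- q ∣ ℚ.< 1ℚ → ∣ p ∣ ℚ.≤ 1ℚ ℚ.+ ∣ q ∣
  ∣∣-bound p q pq = ℚ.≤-trans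
    (subst (λ t → ∣ t ∣ ℚ.≤ ∣ p ℚ.- q ∣ ℚ.+ ∣ q ∣)
      (solve 2 (λ p q → (p :- q) :+ q := p) refl p q)
      (ℚ.∣p+q∣≤∣p∣+∣q∣ (p ℚ.- q) q))
    (ℚ.+-monoˡ-≤ ∣ q ∣ (ℚ.<⇒≤ pq))
    where open +-*-Solver

  <∣∣⇒≢0 : ∀ p {δ} → 0ℚ ℚ.< δ → δ ℚ.< ∣ p ∣ → p ≢ 0ℚ
  <∣∣⇒≢0 _ 0<δ δ<0 refl = ℚ.<-asym 0<δ δ<0

  ∣recip∣-bound : ∀ p {δ} → 0ℚ ℚ.< δ → δ ℚ.< ∣ p ∣ → ∣ recip p ∣ ℚ.≤ recip δ
  ∣recip∣-bound p {δ} 0<δ δ<p = subst₂ ℚ._≤_ lhs rhs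
    (ℚ.*-monoʳ-≤-nonNeg (∣ recip p ∣ ℚ.* recip δ)
      {{ℚ.nonNegative 0≤r}} (ℚ.<⇒≤ δ<p))
    where
    r = ∣ recip p ∣
    d = recip δ
    0≤r : 0ℚ ℚ.≤ r ℚ.* d
    0≤r = subst (ℚ._≤ r ℚ.* d) (ℚ.*-zeroˡ d)
      (ℚ.*-monoʳ-≤-nonNeg d {{ℚ.nonNegative (ℚ.<⇒≤ (recip-pos 0<δ))}}
        (ℚ.0≤∣p∣ (recip p)))
    open +-*-Solver
    lhs : δ ℚ.* (r ℚ.* d) ≡ r
    lhs = trans (solve 3 (λ x y z → x :* (y :* z) := (x :* z) :* y) refl δ r d)
      (trans (cong (ℚ._* r) (recip-inverse δ (0<⇒≢0 0<δ))) (ℚ.*-identityˡ r))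
    rhs : ∣ p ∣ ℚ.* (r ℚ.* d) ≡ d
    rhs = trans (sym (ℚ.*-assoc ∣ p ∣ r d))
      (trans (cong (ℚ._* d)
        (trans (sym (ℚ.∣p*q∣≡∣p∣*∣q∣ p (recip p)))
          (cong ∣_∣ (recip-inverse p (<∣∣⇒≢0 p 0<δ δ<p)))))
        (ℚ.*-identityˡ d))

  recip-close : ∀ p q {δ ε} → 0ℚ ℚ.< δ → δ ℚ.< ∣ p ∣ → δ ℚ.< ∣ q ∣ →
                ∣ p ℚ.- q ∣ ℚ.< ε →
                ∣ recip p ℚ.- recip q ∣ ℚ.< recip δ ℚ.* recip δ ℚ.* ε
  recip-close p q {δ} {ε} 0<δ δ<p δ<q pq =
    subst (ℚ._< d ℚ.* d ℚ.* ε) (sym eq)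
      (*-mono-≤-< (ℚ.0≤∣p∣ (q ℚ.- p)) (0<* 0<d 0<d) bound
        (subst (ℚ._< ε) (∣p-q∣≡∣q-p∣ p q) pq))
    where
    d = recip δ
    P = recip p
    Q = recip q
    0<d = recip-pos 0<δ
    bound : ∣ P ℚ.* Q ∣ ℚ.≤ d ℚ.* d
    bound = subst (ℚ._≤ d ℚ.* d) (sym (ℚ.∣p*q∣≡∣p∣*∣q∣ P Q))
      (ℚ.≤-trans
        (ℚ.*-monoʳ-≤-nonNeg ∣ Q ∣ {{ℚ.nonNegative (ℚ.0≤∣p∣ Q)}}
          (∣recip∣-bound p 0<δ δ<p))
        (ℚ.*-monoˡ-≤-nonNeg d {{ℚ.nonNegative (ℚ.<⇒≤ 0<d)}}
          (∣recip∣-bound q 0<δ δ<q)))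
    open +-*-Solver
    step : P ℚ.- Q ≡ P ℚ.* Q ℚ.* (q ℚ.- p)
    step = trans
      (cong₂ ℚ._-_
        (trans (sym (ℚ.*-identityʳ P))
          (cong (P ℚ.*_) (sym (recip-inverse q (<∣∣⇒≢0 q 0<δ δ<q)))))
        (trans (sym (ℚ.*-identityʳ Q))
          (cong (Q ℚ.*_) (sym (recip-inverse p (<∣∣⇒≢0 p 0<δ δ<p))))))
      (solve 4 (λ p q P Q →
        P :* (q :* Q) :- Q :* (p :* P) := P :* Q :* (q :- p)) refl p q P Q)
    eq : ∣ P ℚ.- Q ∣ ≡ ∣ P ℚ.* Q ∣ ℚ.* ∣ q ℚ.- p ∣
    eq = trans (cong ∣_∣ step) (ℚ.∣p*q∣≡∣p∣*∣q∣ (P ℚ.* Q) (q ℚ.- p))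

  infixl 6 _⊔ˡ_ _⊔ʳ_

  _⊔ˡ_ : ∀ {m n} o → m ℕ.⊔ o ℕ.≤ n → m ℕ.≤ n
  _⊔ˡ_ {m} o = ℕ.≤-trans (ℕ.m≤m⊔n m o)
  _⊔ʳ_ : ∀ {n o} m → m ℕ.⊔ o ℕ.≤ n → o ℕ.≤ n
  _⊔ʳ_ {o = o} m = ℕ.≤-trans (ℕ.m≤n⊔m m o)

-- The real numbers: Cauchy sequences of rationals, equal when their
-- difference tends to 0

record ℝ : Set where
  constructor mkℝ
  field
    seq    : ℕ → ℚ
    cauchy : ∀ ε → 0ℚ ℚ.< ε → ∃ λ N → ∀ m n → N ℕ.≤ m → N ℕ.≤ n →
             ∣ seq m ℚ.- seq n ∣ ℚ.< ε

open ℝ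

infix 4 _≈_

record _≈_ (x y : ℝ) : Set where
  constructor mk≈
  field
    close : ∀ ε → 0ℚ ℚ.< ε → ∃ λ N → ∀ n → N ℕ.≤ n →
            ∣ seq x n ℚ.- seq y n ∣ ℚ.< ε

open _≈_

-- Apartness from 0.  This is what is needed to invert x; classically it is
-- the same as ¬ (x ≈ 0).
record NonZero (x : ℝ) : Set where
  constructor mkNonZero
  field
    radius   : ℚ
    0<radius : 0ℚ ℚ.< radius
    apart    : ∃ λ N → ∀ n → N ℕ.≤ n → radius ℚ.< ∣ seq x n ∣

open NonZero

private
  pointwise : ∀ {x y} → (∀ n → seq x n ≡ seq y n) → x ≈ y
  pointwise {x} {y} eq .close ε 0<ε = 0 , λ n _ →
    subst (λ t → ∣ t ∣ ℚ.< ε)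
      (sym (trans (cong (ℚ._- seq y n) (eq n)) (ℚ.+-inverseʳ (seq y n)))) 0<ε

  bound : ∀ x → ∃ λ B → 0ℚ ℚ.< B × ∃ λ N → ∀ n → N ℕ.≤ n → ∣ seq x n ∣ ℚ.≤ B
  bound x = let N , c = cauchy x 1ℚ 0<1 in
    1ℚ ℚ.+ ∣ seq x N ∣ ,
    ℚ.+-mono-<-≤ 0<1 (ℚ.0≤∣p∣ (seq x N)) ,
    N , λ n N≤n → ∣∣-bound (seq x n) (seq x N) (c n N N≤n ℕ.≤-refl)

  const : ℚ → ℝ
  const q .seq _ = q
  const q .cauchy ε 0<ε = 0 , λ _ _ _ _ →
    subst (λ t → ∣ t ∣ ℚ.< ε) (sym (ℚ.+-inverseʳ q)) 0<ε

infix  8 -_ _⁻¹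
infixl 7 _*_ _/_
infixl 6 _+_

opaque
  0ℝ 1ℝ : ℝ
  0ℝ = const 0ℚ
  1ℝ = const 1ℚ

  _+_ : ℝ → ℝ → ℝ
  (x + y) .seq n = seq x n ℚ.+ seq y n
  (x + y) .cauchy ε 0<ε =
    let δ , 0<δ , eq = halve 0<ε
        M , f = cauchy x δ 0<δ
        N , g = cauchy y δ 0<δ
    in M ℕ.⊔ N , λ m n p q → <-by eq (+-close (seq x m) (seq x n) (seq y m) (seq y n)
      (f m n (N ⊔ˡ p) (N ⊔ˡ q)) (g m n (M ⊔ʳ p) (M ⊔ʳ q)))

  -_ : ℝ → ℝ
  (- x) .seq n = ℚ.- seq x n
  (- x) .cauchy ε 0<ε = let N , f = cauchy x ε 0<ε in
    N , λ m n p q → neg-close (seq x m) (seq x n) (f m n p q)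

  _*_ : ℝ → ℝ → ℝ
  (x * y) .seq n = seq x n ℚ.* seq y n
  (x * y) .cauchy ε 0<ε =
    let A , 0<A , K , a = bound x
        B , 0<B , L , b = bound y
        δ , 0<δ , eq = divide (0<+ 0<A 0<B) 0<ε
        M , f = cauchy x δ 0<δ
        N , g = cauchy y δ 0<δ
    in (K ℕ.⊔ L) ℕ.⊔ (M ℕ.⊔ N) , λ m n p q → <-by eq (*-close (seq x m) (seq x n) (seq y m) (seq y n) 0<A 0<B
      (a m (L ⊔ˡ (M ℕ.⊔ N ⊔ˡ p))) (b n (K ⊔ʳ (M ℕ.⊔ N ⊔ˡ q)))
      (f m n (N ⊔ˡ (K ℕ.⊔ L ⊔ʳ p)) (N ⊔ˡ (K ℕ.⊔ L ⊔ʳ q)))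
      (g m n (M ⊔ʳ (K ℕ.⊔ L ⊔ʳ p)) (M ⊔ʳ (K ℕ.⊔ L ⊔ʳ q))))

  _⁻¹ : (x : ℝ) {{_ : NonZero x}} → ℝ
  (x ⁻¹) .seq n = recip (seq x n)
  (_⁻¹ x {{mkNonZero δ 0<δ (M , a)}}) .cauchy ε 0<ε =
    let η , 0<η , eq = divide (0<* (recip-pos 0<δ) (recip-pos 0<δ)) 0<ε
        N , f = cauchy x η 0<η
    in M ℕ.⊔ N , λ m n p q → <-by eq (recip-close (seq x m) (seq x n) 0<δ (a m (N ⊔ˡ p)) (a n (N ⊔ˡ q))
      (f m n (M ⊔ʳ p) (M ⊔ʳ q)))

_/_ : (x y : ℝ) {{_ : NonZero y}} → ℝ
x / y = x * y ⁻¹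

≈-isEquivalence : IsEquivalence _≈_
≈-isEquivalence = record { refl = pointwise λ _ → refl ; sym = ≈-sym ; trans = ≈-trans }
  where
  ≈-sym : ∀ {x y} → x ≈ y → y ≈ x
  ≈-sym {x} {y} x≈y .close ε 0<ε = let N , f = close x≈y ε 0<ε in
    N , λ n p →
    subst (ℚ._< ε) (∣p-q∣≡∣q-p∣ (seq x n) (seq y n)) (f n p)

  ≈-trans : ∀ {x y z} → x ≈ y → y ≈ z → x ≈ z
  ≈-trans {x} {y} {z} x≈y y≈z .close ε 0<ε =
    let δ , 0<δ , eq = halve 0<ε
        M , f = close x≈y δ 0<δ
        N , g = close y≈z δ 0<δ
    in M ℕ.⊔ N , λ n p → <-by eq
      (triangle (seq x n) (seq y n) (seq z n) (f n (N ⊔ˡ p)) (g n (M ⊔ʳ p)))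

opaque
  unfolding 0ℝ

  +-cong : ∀ {x x′ y y′} → x ≈ x′ → y ≈ y′ → x + y ≈ x′ + y′
  +-cong {x} {x′} {y} {y′} x≈x′ y≈y′ .close ε 0<ε =
    let δ , 0<δ , eq = halve 0<ε
        M , f = close x≈x′ δ 0<δ
        N , g = close y≈y′ δ 0<δ
    in M ℕ.⊔ N , λ n p → <-by eq (+-close (seq x n) (seq x′ n) (seq y n) (seq y′ n)
      (f n (N ⊔ˡ p)) (g n (M ⊔ʳ p)))

  -‿cong : ∀ {x x′} → x ≈ x′ → - x ≈ - x′
  -‿cong {x} {x′} x≈x′ .close ε 0<ε = let N , f = close x≈x′ ε 0<ε in
    N , λ n p → neg-close (seq x n) (seq x′ n) (f n p)

  *-cong : ∀ {x x′ y y′} → x ≈ x′ → y ≈ y′ → x * y ≈ x′ * y′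
  *-cong {x} {x′} {y} {y′} x≈x′ y≈y′ .close ε 0<ε =
    let A , 0<A , K , a = bound x
        B , 0<B , L , b = bound y′
        δ , 0<δ , eq = divide (0<+ 0<A 0<B) 0<ε
        M , f = close x≈x′ δ 0<δ
        N , g = close y≈y′ δ 0<δ
    in (K ℕ.⊔ L) ℕ.⊔ (M ℕ.⊔ N) , λ n p → <-by eq (*-close (seq x n) (seq x′ n) (seq y n) (seq y′ n) 0<A 0<B
      (a n (L ⊔ˡ (M ℕ.⊔ N ⊔ˡ p))) (b n (K ⊔ʳ (M ℕ.⊔ N ⊔ˡ p)))
      (f n (N ⊔ˡ (K ℕ.⊔ L ⊔ʳ p))) (g n (M ⊔ʳ (K ℕ.⊔ L ⊔ʳ p))))

  +-*-isCommutativeRing : IsCommutativeRing _≈_ _+_ _*_ -_ 0ℝ 1ℝ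
  +-*-isCommutativeRing = record
    { isRing = record
      { +-isAbelianGroup = record
        { isGroup = record
          { isMonoid = record
            { isSemigroup = record
              { isMagma = record
                { isEquivalence = ≈-isEquivalence ; ∙-cong = +-cong }
              ; assoc = λ x y z → pointwise λ n →
                  ℚ.+-assoc (seq x n) (seq y n) (seq z n)
              }
            ; identity = (λ x → pointwise λ n → ℚ.+-identityˡ (seq x n))
                       , (λ x → pointwise λ n → ℚ.+-identityʳ (seq x n))
            }
          ; inverse = (λ x → pointwise λ n → ℚ.+-inverseˡ (seq x n))
                    , (λ x → pointwise λ n → ℚ.+-inverseʳ (seq x n))
          ; ⁻¹-cong = -‿cong
          }
        ; comm = λ x y → pointwise λ n → ℚ.+-comm (seq x n) (seq y n)
        }
      ; *-cong = *-cong
      ; *-assoc = λ x y z → pointwise λ n →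
          ℚ.*-assoc (seq x n) (seq y n) (seq z n)
      ; *-identity = (λ x → pointwise λ n → ℚ.*-identityˡ (seq x n))
                   , (λ x → pointwise λ n → ℚ.*-identityʳ (seq x n))
      ; distrib = (λ x y z → pointwise λ n →
                    ℚ.*-distribˡ-+ (seq x n) (seq y n) (seq z n))
                , (λ x y z → pointwise λ n →
                    ℚ.*-distribʳ-+ (seq x n) (seq y n) (seq z n))
      }
    ; *-comm = λ x y → pointwise λ n → ℚ.*-comm (seq x n) (seq y n)
    }

  *-inverseʳ : ∀ x {{_ : NonZero x}} → x * x ⁻¹ ≈ 1ℝ
  *-inverseʳ x {{mkNonZero δ 0<δ (N , a)}} .close ε 0<ε = N , λ n p →
    subst (λ t → ∣ t ℚ.- 1ℚ ∣ ℚ.< ε)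
      (sym (recip-inverse (seq x n) (<∣∣⇒≢0 (seq x n) 0<δ (a n p)))) 0<ε

  1-nonZero : NonZero 1ℝ
  1-nonZero = mkNonZero ℚ.½ (ℚ.positive⁻¹ ℚ.½) (0 , λ _ _ → ½<1)
    where
    ½<1 : ℚ.½ ℚ.< 1ℚ
    ½<1 = ℚ.*<* (ℤ.+<+ (ℕ.s≤s (ℕ.s≤s ℕ.z≤n)))

  *-nonZero : ∀ {x y} → NonZero x → NonZero y → NonZero (x * y)
  *-nonZero {x} {y} (mkNonZero δ 0<δ (M , a)) (mkNonZero ε 0<ε (N , b)) =
    mkNonZero (δ ℚ.* ε) (0<* 0<δ 0<ε) (M ℕ.⊔ N , λ n p →
      subst (δ ℚ.* ε ℚ.<_) (sym (ℚ.∣p*q∣≡∣p∣*∣q∣ (seq x n) (seq y n)))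
        (*-mono-≤-< (ℚ.<⇒≤ 0<ε) (ℚ.<-trans 0<δ (a n (N ⊔ˡ p)))
          (ℚ.<⇒≤ (a n (N ⊔ˡ p))) (b n (M ⊔ʳ p))))

+-*-commutativeRing : CommutativeRing 0ℓ 0ℓ
+-*-commutativeRing = record { isCommutativeRing = +-*-isCommutativeRing }

open CommutativeRing +-*-commutativeRing using (semiring)
open SemiringExp semiring public using (_^_)
open SemiringMult semiring public using () renaming (_×_ to _·_)
open SemiringSum semiring public using (sum)

instance
  *-NonZero : ∀ {x y} {{_ : NonZero x}} {{_ : NonZero y}} → NonZero (x * y)
  *-NonZero {{x≉0}} {{y≉0}} = *-nonZero x≉0 y≉0

-- Not an instance: instance search would get stuck on  x ^ n = y.
^-nonZero : ∀ x n {{_ : NonZero x}} → NonZero (x ^ n)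
^-nonZero x zero          = 1-nonZero
^-nonZero x (suc n) {{p}} = *-nonZero p (^-nonZero x n)

infixr 8 _^ᶻ_

_^ᶻ_ : (x : ℝ) {{_ : NonZero x}} → ℤ → ℝ
x ^ᶻ (+ n)    = x ^ n
x ^ᶻ -[1+ n ] = (x ⁻¹) ^ suc n

-- Σ[ i ≤ n ] f i  is  f 0 + ... + f n.
infix 5 Σ≤-syntax

Σ≤-syntax : ∀ n → (ℕ → ℝ) → ℝ
Σ≤-syntax n f = sum {suc n} λ i → f (toℕ i)

syntax Σ≤-syntax n (λ i → e) = Σ[ i ≤ n ] e

ζ : ℕ → ℕ
ζ n with parity n
... | 0ℙ = 0
... | 1ℙ = 1

χ : ℝ → ℝ → ℕ → ℝ
χ a b n with parity n
... | 0ℙ = a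
... | 1ℙ = b

module BiPeriodic (a b c : ℝ) where

  u : ℕ → ℝ
  u 0               = 0ℝ
  u 1               = 1ℝ
  u n@(suc (suc k)) = χ a b n * u (suc k) + c * u k

  v : ℕ → ℝ
  v 0               = 1ℝ + 1ℝ
  v 1               = b
  v n@(suc (suc k)) = χ a b n * v (suc k) + c * v k

  δ : {{_ : NonZero a}} {{_ : NonZero b}} → (m n r i : ℕ) → ℝ
  δ m n r i =
    (a * b) ^ (⌊ i ℕ.+ r /2⌋ ℕ.+ n ℕ.* ⌊ m /2⌋)
    * a ^ᶻ (ℤ.- (+ (ζ (m ℕ.+ 1) ℕ.* i)) ℤ.- 1ℤ ℤ.+ + ζ (i ℕ.+ r))
    * b ^ (ζ m ℕ.* (n ℕ.∸ i))

{-# OPTIONS --safe #-}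

-- Rescaling a solution w of the bi-periodic recurrence to
-- x n = (ab)^⌊n/2⌋ a^(ζ(n)-1) w n makes the coefficients constant:
-- x (n+2) = ab x (n+1) + abc x n.  For y the rescaled u, the addition formula
-- x (m+n) = y m x (n+1) + abc y (m-1) x n says that shifting by m is the linear
-- combination of two commuting operators (shift by 1 and the identity), so its
-- n-th power is given by the binomial theorem.  Undoing the rescaling produces
-- the factor δ.

module Submission where

open import Algebra.Bundles using (CommutativeRing; CommutativeSemiring)
open import Data.Fin.Base using (toℕ)
open import Data.Fin.Properties using (toℕ-inject₁; toℕ-fromℕ; toℕ≤pred[n])
open import Data.Integer.Base as ℤ using (+_; 1ℤ)
open import Data.Nat.Base as ℕ using (ℕ; zero; suc; ⌊_/2⌋; parity)
open import Data.Nat.Combinatorics using (_C_; k>n⇒nCk≡0; nCk+nC[k+1]≡[n+1]C[k+1])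
import Data.Nat.Properties as ℕ
open import Data.Parity.Base using (0ℙ; 1ℙ)
open import Data.Product.Base using (_×_; _,_)
open import Relation.Binary.PropositionalEquality as ≡ using (_≡_)
open import Defs using (ζ)

-- Binomial expansion of an iterated shift

module BinomialShift {c ℓ} (R : CommutativeSemiring c ℓ) where

  open CommutativeSemiring R
  open import Algebra.Properties.Semiring.Exp semiring using (_^_)
  open import Algebra.Properties.Semiring.Mult semiring
    using (×-congˡ; ×-congʳ; ×-homo-+; ×-comm-*)
    renaming (_×_ to _·_)
  open import Algebra.Properties.Semiring.Sum semiring
    using (sum; sum-cong-≋; sum-init-last; *-distribˡ-sum; ∑-distrib-+)
  open import Algebra.Solver.Ring.NaturalCoefficients.Default R
  open import Relation.Binary.Reasoning.Setoid setoid

  -- Unfolds to the same `sum` as the one in the theorem, so results over a general semiring apply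
  -- there without conversion.
  Σ≤ : ℕ → (ℕ → Carrier) → Carrier
  Σ≤ n f = sum {suc n} λ i → f (toℕ i)

  Σ≤-cong : ∀ n {f g : ℕ → Carrier} → (∀ i → i ℕ.≤ n → f i ≈ g i) → Σ≤ n f ≈ Σ≤ n g
  Σ≤-cong n f≈g = sum-cong-≋ {suc n} λ i → f≈g (toℕ i) (toℕ≤pred[n] i)

  Σ≤-last : ∀ n f → Σ≤ (suc n) f ≈ Σ≤ n f + f (suc n)
  Σ≤-last n f = trans (sum-init-last {suc n} (λ i → f (toℕ i)))
    (+-cong (sum-cong-≋ {suc n} λ i → reflexive (≡.cong f (toℕ-inject₁ i)))
            (reflexive (≡.cong f (toℕ-fromℕ (suc n)))))

  Σ≤-distrib-+ : ∀ n f g → Σ≤ n (λ i → f i + g i) ≈ Σ≤ n f + Σ≤ n g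
  Σ≤-distrib-+ n f g = ∑-distrib-+ {suc n} (λ i → f (toℕ i)) (λ i → g (toℕ i))

  *-distribˡ-Σ≤ : ∀ n x f → x * Σ≤ n f ≈ Σ≤ n (λ i → x * f i)
  *-distribˡ-Σ≤ n x f = *-distribˡ-sum {suc n} x (λ i → f (toℕ i))

  module _ (A B : Carrier) where

    term : ℕ → (ℕ → Carrier) → ℕ → Carrier
    term n x i = (n C i) · (A ^ i * B ^ (n ℕ.∸ i) * x i)

    -- Pascal's rule splits each coefficient: the `n C i` part of term `suc i` has a spare factor
    -- `A` and the shifted `x`, the `n C suc i` part a spare factor `B`.
    Σ≤-pascal : ∀ n x →
      Σ≤ (suc n) (term (suc n) x) ≈
      A * Σ≤ n (term n (λ i → x (suc i))) + B * Σ≤ n (term n x)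
    Σ≤-pascal n x = begin
      t 0 + Σ≤ n (λ i → term (suc n) x (suc i))
        ≈⟨ +-congˡ (Σ≤-cong n λ i _ → split i) ⟩
      s 0 + Σ≤ n (λ i → A * term n x⁺ i + s (suc i))
        ≈⟨ +-congˡ (Σ≤-distrib-+ n (λ i → A * term n x⁺ i) (λ i → s (suc i))) ⟩
      s 0 + (Σ≤ n (λ i → A * term n x⁺ i) + Σ≤ n (λ i → s (suc i)))
        ≈⟨ solve 3 (λ p q r → p :+ (q :+ r) := q :+ (p :+ r)) refl _ _ _ ⟩
      Σ≤ n (λ i → A * term n x⁺ i) + Σ≤ (suc n) s
        ≈⟨ +-cong (sym (*-distribˡ-Σ≤ n A (term n x⁺))) tail ⟩
      A * Σ≤ n (term n x⁺) + B * Σ≤ n (term n x) ∎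
      where
      x⁺ : ℕ → Carrier
      x⁺ i = x (suc i)

      -- `s` has `n C i` where `t` has `suc n C i`. At `i = 0` both coefficients compute to 1, so
      -- `t 0` and `s 0` agree definitionally.
      t s : ℕ → Carrier
      t = term (suc n) x
      s i = (n C i) · (A ^ i * B ^ (suc n ℕ.∸ i) * x i)

      split : ∀ i → t (suc i) ≈ A * term n x⁺ i + s (suc i)
      split i = begin
        t (suc i)
          ≈⟨ ×-congˡ (≡.sym (nCk+nC[k+1]≡[n+1]C[k+1] n i)) ⟩
        (n C i ℕ.+ n C suc i) · (A * A ^ i * B ^ (n ℕ.∸ i) * x (suc i))
          ≈⟨ ×-homo-+ _ (n C i) (n C suc i) ⟩
        (n C i) · (A * A ^ i * B ^ (n ℕ.∸ i) * x (suc i)) + s (suc i)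
          ≈⟨ +-congʳ (×-congʳ (n C i) (solve 4 (λ p q r y →
               p :* q :* r :* y := p :* (q :* r :* y)) refl _ _ _ _)) ⟩
        (n C i) · (A * (A ^ i * B ^ (n ℕ.∸ i) * x (suc i))) + s (suc i)
          ≈⟨ +-congʳ (sym (×-comm-* (n C i) A _)) ⟩
        A * term n x⁺ i + s (suc i) ∎

      -- Subtraction is truncated, so it takes `i ≤ n` for `suc n ∸ i` to yield one more factor `B`.
      scale : ∀ i → i ℕ.≤ n → s i ≈ B * term n x i
      scale i i≤n = begin
        (n C i) · (A ^ i * B ^ (suc n ℕ.∸ i) * x i)
          ≡⟨ ≡.cong (λ k → (n C i) · (A ^ i * B ^ k * x i)) (ℕ.+-∸-assoc 1 i≤n) ⟩
        (n C i) · (A ^ i * (B * B ^ (n ℕ.∸ i)) * x i)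
          ≈⟨ ×-congʳ (n C i) (solve 4 (λ p q r y →
               p :* (q :* r) :* y := q :* (p :* r :* y)) refl _ _ _ _) ⟩
        (n C i) · (B * (A ^ i * B ^ (n ℕ.∸ i) * x i))
          ≈⟨ ×-comm-* (n C i) B _ ⟨
        B * term n x i ∎

      tail : Σ≤ (suc n) s ≈ B * Σ≤ n (term n x)
      tail = begin
        Σ≤ (suc n) s
          ≈⟨ Σ≤-last n s ⟩
        Σ≤ n s + s (suc n)
          -- The last index `suc n` is out of reach of `scale`, but its coefficient `n C suc n` is
          -- zero.
          ≈⟨ +-cong (Σ≤-cong n scale) (×-congˡ (k>n⇒nCk≡0 (ℕ.n<1+n n))) ⟩
        Σ≤ n (λ i → B * term n x i) + 0#
          ≈⟨ +-identityʳ _ ⟩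
        Σ≤ n (λ i → B * term n x i)
          ≈⟨ *-distribˡ-Σ≤ n B (term n x) ⟨
        B * Σ≤ n (term n x) ∎

    -- Induction on `n` with `r` free: one use of `shift` leaves the case `n` at `suc r` and at `r`,
    -- and `Σ≤-pascal` merges the two sums.
    binomial-shift : ∀ (x : ℕ → Carrier) m →
      (∀ n → x (m ℕ.+ n) ≈ A * x (suc n) + B * x n) →
      ∀ n r → x (m ℕ.* n ℕ.+ r) ≈ Σ≤ n (term n (λ i → x (i ℕ.+ r)))
    binomial-shift x m shift zero r = begin
      x (m ℕ.* 0 ℕ.+ r)
        ≡⟨ ≡.cong (λ k → x (k ℕ.+ r)) (ℕ.*-zeroʳ m) ⟩
      x r
        ≈⟨ solve 1 (λ y → y := con 1 :* con 1 :* y :+ con 0 :+ con 0) refl _ ⟩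
      Σ≤ 0 (term 0 (λ i → x (i ℕ.+ r))) ∎
    binomial-shift x m shift (suc n) r = begin
      x (m ℕ.* suc n ℕ.+ r)
        ≡⟨ ≡.cong x (≡.trans (≡.cong (ℕ._+ r) (ℕ.*-suc m n)) (ℕ.+-assoc m (m ℕ.* n) r)) ⟩
      x (m ℕ.+ (m ℕ.* n ℕ.+ r))
        ≈⟨ shift (m ℕ.* n ℕ.+ r) ⟩
      A * x (suc (m ℕ.* n ℕ.+ r)) + B * x (m ℕ.* n ℕ.+ r)
        ≡⟨ ≡.cong (λ k → A * x k + B * x (m ℕ.* n ℕ.+ r)) (≡.sym (ℕ.+-suc (m ℕ.* n) r)) ⟩
      A * x (m ℕ.* n ℕ.+ suc r) + B * x (m ℕ.* n ℕ.+ r)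
        ≈⟨ +-cong (*-congˡ (binomial-shift x m shift n (suc r)))
                  (*-congˡ (binomial-shift x m shift n r)) ⟩
      A * Σ≤ n (term n (λ i → x (i ℕ.+ suc r))) + B * Σ≤ n (term n (λ i → x (i ℕ.+ r)))
        ≈⟨ +-congʳ (*-congˡ (Σ≤-cong n λ i _ →
             reflexive (≡.cong (λ k → (n C i) · (A ^ i * B ^ (n ℕ.∸ i) * x k)) (ℕ.+-suc i r)))) ⟩
      A * Σ≤ n (term n (λ i → x (suc i ℕ.+ r))) + B * Σ≤ n (term n (λ i → x (i ℕ.+ r)))
        ≈⟨ Σ≤-pascal n (λ i → x (i ℕ.+ r)) ⟨
      Σ≤ (suc n) (term (suc n) (λ i → x (i ℕ.+ r))) ∎

  -- Induction on `k` with `n` free: one step is moved from `k` to `n`, `x (2 + n)` is expanded, and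
  -- the coefficients of `x (suc n)` regroup into the recurrence for `y (2 + k)`.
  addition-formula : ∀ P Q (x y : ℕ → Carrier) →
    (∀ n → x (2 ℕ.+ n) ≈ P * x (suc n) + Q * x n) →
    (∀ n → y (2 ℕ.+ n) ≈ P * y (suc n) + Q * y n) →
    y 0 ≈ 0# → y 1 ≈ 1# →
    ∀ k n → x (suc k ℕ.+ n) ≈ y (suc k) * x (suc n) + Q * y k * x n
  addition-formula P Q x y x-rec y-rec y0 y1 = go
    where
    go : ∀ k n → x (suc k ℕ.+ n) ≈ y (suc k) * x (suc n) + Q * y k * x n
    go zero n = begin
      x (suc n)
        ≈⟨ solve 3 (λ p q z → p := con 1 :* p :+ q :* con 0 :* z) refl _ Q (x n) ⟩
      1# * x (suc n) + Q * 0# * x n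
        ≈⟨ +-cong (*-congʳ (sym y1)) (*-congʳ (*-congˡ (sym y0))) ⟩
      y 1 * x (suc n) + Q * y 0 * x n ∎
    go (suc k) n = begin
      x (2 ℕ.+ k ℕ.+ n)
        ≡⟨ ≡.cong (λ j → x (suc j)) (ℕ.+-suc k n) ⟨
      x (suc k ℕ.+ suc n)
        ≈⟨ go k (suc n) ⟩
      y (suc k) * x (2 ℕ.+ n) + Q * y k * x (suc n)
        ≈⟨ +-congʳ (*-congˡ (x-rec n)) ⟩
      y (suc k) * (P * x (suc n) + Q * x n) + Q * y k * x (suc n)
        ≈⟨ solve 6 (λ p q s t v w → s :* (p :* v :+ q :* w) :+ q :* t :* v :=
             (p :* s :+ q :* t) :* v :+ q :* s :* w) refl P Q _ _ _ _ ⟩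
      (P * y (suc k) + Q * y k) * x (suc n) + Q * y (suc k) * x n
        ≈⟨ +-congʳ (*-congʳ (sym (y-rec k))) ⟩
      y (2 ℕ.+ k) * x (suc n) + Q * y (suc k) * x n ∎

-- The parity function

ζ-2+ : ∀ n → ζ (2 ℕ.+ n) ≡ ζ n
ζ-2+ n with parity n
... | 0ℙ = ≡.refl
... | 1ℙ = ≡.refl

-- Turns the exponent `1 ∸ ζ m` of the rescaling into the `ζ (m + 1)` of `δ`.
ζ-suc : ∀ n → 1 ℕ.∸ ζ n ≡ ζ (suc n)
ζ-suc zero = ≡.refl
ζ-suc (suc zero) = ≡.refl
ζ-suc (suc (suc n)) = ≡.trans (≡.cong (1 ℕ.∸_) (ζ-2+ n))
  (≡.trans (ζ-suc n) (≡.sym (ζ-2+ (suc n))))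

-- Rescaling to constant coefficients

module _ {ℓ₁ ℓ₂} (R : CommutativeSemiring ℓ₁ ℓ₂) where

  open CommutativeSemiring R

  -- `α` is the inverse of `a`: negative powers of `a` become natural powers of `α`, which keeps the
  -- argument inside a commutative semiring and its solver.
  module Rescaling
    (a b c α : Carrier) (a*α≈1 : a * α ≈ 1#)
    (χ : ℕ → Carrier) (χ-0 : χ 0 ≈ a) (χ-1 : χ 1 ≈ b) (χ-2+ : ∀ n → χ (2 ℕ.+ n) ≈ χ n)
    where

    open import Algebra.Properties.Semiring.Exp semiring
      using (_^_; ^-homo-*; ^-assocʳ; ^-congˡ)
    open import Algebra.Properties.CommutativeSemiring.Exp R using (^-distrib-*)
    open import Algebra.Properties.Semiring.Mult semiring
      using (×-congʳ) renaming (_×_ to _·_)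
    open import Algebra.Solver.Ring.NaturalCoefficients.Default R
    open import Relation.Binary.Reasoning.Setoid setoid
    open BinomialShift R

    scale : ℕ → Carrier
    scale n = (a * b) ^ ⌊ n /2⌋ * α ^ (1 ℕ.∸ ζ n)

    scale-2+ : ∀ n → scale (2 ℕ.+ n) ≈ a * b * scale n
    scale-2+ n = trans
      (reflexive (≡.cong (λ j → a * b * (a * b) ^ ⌊ n /2⌋ * α ^ (1 ℕ.∸ j)) (ζ-2+ n)))
      (*-assoc _ _ _)

    -- For odd `n` the `α` cancels the `a` of one factor `a * b` and leaves `b`. This is the source
    -- of the power of `b` in `δ`.
    scale-suc : ∀ n → scale (suc n) ≈ (a * b) ^ ⌊ n /2⌋ * b ^ ζ n
    scale-suc zero = refl
    scale-suc (suc zero) = begin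
      a * b * 1# * (α * 1#)
        ≈⟨ solve 3 (λ a b α → a :* b :* con 1 :* (α :* con 1) :=
             a :* α :* (b :* con 1)) refl a b α ⟩
      a * α * (b * 1#)
        ≈⟨ *-congʳ a*α≈1 ⟩
      1# * (b * 1#) ∎
    scale-suc (suc (suc n)) = begin
      scale (3 ℕ.+ n)
        ≈⟨ scale-2+ (suc n) ⟩
      a * b * scale (suc n)
        ≈⟨ *-congˡ (scale-suc n) ⟩
      a * b * ((a * b) ^ ⌊ n /2⌋ * b ^ ζ n)
        ≈⟨ *-assoc _ _ _ ⟨
      a * b * (a * b) ^ ⌊ n /2⌋ * b ^ ζ n
        ≡⟨ ≡.cong (λ j → a * b * (a * b) ^ ⌊ n /2⌋ * b ^ j) (ζ-2+ n) ⟨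
      (a * b) ^ ⌊ 2 ℕ.+ n /2⌋ * b ^ ζ (2 ℕ.+ n) ∎

    -- The reason for the choice of `scale`: its successive ratios are the periodic coefficients, so
    -- rescaling absorbs `χ n`.
    scale-suc-χ : ∀ n → scale (suc n) ≈ scale n * χ n
    scale-suc-χ zero = begin
      1# * 1#
        ≈⟨ *-congˡ a*α≈1 ⟨
      1# * (a * α)
        ≈⟨ solve 2 (λ a α → con 1 :* (a :* α) := con 1 :* (α :* con 1) :* a) refl a α ⟩
      1# * (α * 1#) * a
        ≈⟨ *-congˡ χ-0 ⟨
      1# * (α * 1#) * χ 0 ∎
    scale-suc-χ (suc zero) = begin
      a * b * 1# * (α * 1#)
        ≈⟨ solve 3 (λ a b α → a :* b :* con 1 :* (α :* con 1) := a :* α :* con 1 :* b) refl a b α ⟩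
      a * α * 1# * b
        ≈⟨ *-cong (*-congʳ a*α≈1) (sym χ-1) ⟩
      1# * 1# * χ 1 ∎
    scale-suc-χ (suc (suc n)) = begin
      scale (3 ℕ.+ n)
        ≈⟨ scale-2+ (suc n) ⟩
      a * b * scale (suc n)
        ≈⟨ *-congˡ (scale-suc-χ n) ⟩
      a * b * (scale n * χ n)
        ≈⟨ *-assoc _ _ _ ⟨
      a * b * scale n * χ n
        ≈⟨ *-cong (scale-2+ n) (χ-2+ n) ⟨
      scale (2 ℕ.+ n) * χ (2 ℕ.+ n) ∎

    ^-inverse : ∀ n → a ^ n * α ^ n ≈ 1#
    ^-inverse zero = *-identityˡ 1#
    ^-inverse (suc n) = begin
      a * a ^ n * (α * α ^ n)
        ≈⟨ solve 4 (λ a p α q → a :* p :* (α :* q) := a :* α :* (p :* q)) refl a (a ^ n) α (α ^ n) ⟩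
      a * α * (a ^ n * α ^ n)
        ≈⟨ *-cong a*α≈1 (^-inverse n) ⟩
      1# * 1#
        ≈⟨ *-identityˡ 1# ⟩
      1# ∎

    -- `q` stands for the inverse of the power of `a * b`; undoing `scale n` with it gives the
    -- prefactor of the theorem.
    unscale : ∀ n y q → (a * b) ^ ⌊ n /2⌋ * q ≈ 1# →
      y ≈ a ^ (1 ℕ.∸ ζ n) * q * (scale n * y)
    unscale n y q p*q≈1 = begin
      y
        ≈⟨ solve 1 (λ y → y := con 1 :* con 1 :* y) refl y ⟩
      1# * 1# * y
        ≈⟨ *-congʳ (*-cong (^-inverse (1 ℕ.∸ ζ n)) p*q≈1) ⟨
      a ^ (1 ℕ.∸ ζ n) * α ^ (1 ℕ.∸ ζ n) * ((a * b) ^ ⌊ n /2⌋ * q) * y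
        ≈⟨ solve 5 (λ r s p q y → r :* s :* (p :* q) :* y := r :* q :* (p :* s :* y)) refl _ _ _ q y ⟩
      a ^ (1 ℕ.∸ ζ n) * q * (scale n * y) ∎

    SatisfiesRecurrence : (ℕ → Carrier) → Set ℓ₂
    SatisfiesRecurrence w = ∀ n → w (2 ℕ.+ n) ≈ χ n * w (suc n) + c * w n

    scaled-recurrence : ∀ {w} → SatisfiesRecurrence w → ∀ n →
      scale (2 ℕ.+ n) * w (2 ℕ.+ n) ≈
      a * b * (scale (suc n) * w (suc n)) + a * b * c * (scale n * w n)
    scaled-recurrence {w} w-rec n = begin
      scale (2 ℕ.+ n) * w (2 ℕ.+ n)
        ≈⟨ *-cong (scale-2+ n) (w-rec n) ⟩
      a * b * scale n * (χ n * w (suc n) + c * w n)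
        ≈⟨ solve 6 (λ p q r y s z → p :* q :* (r :* y :+ s :* z) :=
             p :* (q :* r :* y) :+ p :* s :* (q :* z)) refl (a * b) _ _ _ _ _ ⟩
      a * b * (scale n * χ n * w (suc n)) + a * b * c * (scale n * w n)
        ≈⟨ +-congʳ (*-congˡ (*-congʳ (scale-suc-χ n))) ⟨
      a * b * (scale (suc n) * w (suc n)) + a * b * c * (scale n * w n) ∎

    module _ (u : ℕ → Carrier) where

      -- The exponent of `a` in `δ` is split into -ζ(m+1)i and -(1-ζ(i+r)), giving two natural
      -- powers of `α`.
      summand : (w : ℕ → Carrier) (k n r i : ℕ) → Carrier
      summand w k n r i =
        c ^ (n ℕ.∸ i) * u m ^ i * u k ^ (n ℕ.∸ i) * w (i ℕ.+ r)
        * ((a * b) ^ (⌊ i ℕ.+ r /2⌋ ℕ.+ n ℕ.* ⌊ m /2⌋)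
           * (α ^ (ζ (m ℕ.+ 1) ℕ.* i) * α ^ (1 ℕ.∸ ζ (i ℕ.+ r)))
           * b ^ (ζ m ℕ.* (n ℕ.∸ i)))
        where
        m = suc k

      -- The left side is the term that `binomial-shift` produces for the rescaled sequences.
      -- Distributing the powers over each base and gathering those of `a * b` and `α` recovers `δ`.
      scaled-summand : ∀ w k n r i → i ℕ.≤ n →
        (scale (suc k) * u (suc k)) ^ i * (a * b * c * (scale k * u k)) ^ (n ℕ.∸ i)
          * (scale (i ℕ.+ r) * w (i ℕ.+ r)) ≈
        summand w k n r i
      scaled-summand w k n r i i≤n = begin
        (scale m * u m) ^ i * (a * b * c * (scale k * u k)) ^ j * (scale p * w p)
          ≈⟨ *-congʳ (*-cong base₁ base₂) ⟩
        S ^ i * α ^ (ζ (m ℕ.+ 1) ℕ.* i) * u m ^ i * (c ^ j * u k ^ j * (S ^ j * b ^ (ζ m ℕ.* j)))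
          * ((a * b) ^ ⌊ p /2⌋ * α ^ (1 ℕ.∸ ζ p) * w p)
          ≈⟨ solve 10 (λ si z ui cj uj sj bj h e y →
               si :* z :* ui :* (cj :* uj :* (sj :* bj)) :* (h :* e :* y) :=
               cj :* ui :* uj :* y :* (h :* (si :* sj) :* (z :* e) :* bj))
             refl _ _ _ _ _ _ _ _ _ _ ⟩
        c ^ j * u m ^ i * u k ^ j * w p *
          ((a * b) ^ ⌊ p /2⌋ * (S ^ i * S ^ j)
           * (α ^ (ζ (m ℕ.+ 1) ℕ.* i) * α ^ (1 ℕ.∸ ζ p)) * b ^ (ζ m ℕ.* j))
          ≈⟨ *-congˡ (*-congʳ (*-congʳ (trans (*-congˡ powers)
               (sym (^-homo-* (a * b) ⌊ p /2⌋ (n ℕ.* ⌊ m /2⌋)))))) ⟩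
        summand w k n r i ∎
        where
        m = suc k
        j = n ℕ.∸ i
        p = i ℕ.+ r
        S = (a * b) ^ ⌊ m /2⌋

        base₁ : (scale m * u m) ^ i ≈ S ^ i * α ^ (ζ (m ℕ.+ 1) ℕ.* i) * u m ^ i
        base₁ = begin
          (S * α ^ (1 ℕ.∸ ζ m) * u m) ^ i
            ≡⟨ ≡.cong (λ e → (S * α ^ e * u m) ^ i)
                 (≡.trans (ζ-suc m) (≡.cong ζ (ℕ.+-comm 1 m))) ⟩
          (S * α ^ ζ (m ℕ.+ 1) * u m) ^ i
            ≈⟨ ^-distrib-* _ _ i ⟩
          (S * α ^ ζ (m ℕ.+ 1)) ^ i * u m ^ i
            ≈⟨ *-congʳ (^-distrib-* _ _ i) ⟩
          S ^ i * (α ^ ζ (m ℕ.+ 1)) ^ i * u m ^ i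
            ≈⟨ *-congʳ (*-congˡ (^-assocʳ α (ζ (m ℕ.+ 1)) i)) ⟩
          S ^ i * α ^ (ζ (m ℕ.+ 1) ℕ.* i) * u m ^ i ∎

        base₂ : (a * b * c * (scale k * u k)) ^ j ≈ c ^ j * u k ^ j * (S ^ j * b ^ (ζ m ℕ.* j))
        base₂ = begin
          (a * b * c * (scale k * u k)) ^ j
            ≈⟨ ^-congˡ j (solve 4 (λ t c s y → t :* c :* (s :* y) := c :* y :* (t :* s))
                 refl (a * b) c (scale k) (u k)) ⟩
          (c * u k * (a * b * scale k)) ^ j
            -- As `m = suc k`, `a * b * scale k` equals `scale (suc m)`, whose power of `a * b` is
            -- again `S`.
            ≈⟨ ^-congˡ j (*-congˡ (trans (sym (scale-2+ k)) (scale-suc m))) ⟩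
          (c * u k * (S * b ^ ζ m)) ^ j
            ≈⟨ ^-distrib-* _ _ j ⟩
          (c * u k) ^ j * (S * b ^ ζ m) ^ j
            ≈⟨ *-cong (^-distrib-* _ _ j) (^-distrib-* _ _ j) ⟩
          c ^ j * u k ^ j * (S ^ j * (b ^ ζ m) ^ j)
            ≈⟨ *-congˡ (*-congˡ (^-assocʳ b (ζ m) j)) ⟩
          c ^ j * u k ^ j * (S ^ j * b ^ (ζ m ℕ.* j)) ∎

        -- Both bases contribute the same `S`, so for `i ≤ n` the exponents add up to `n`,
        -- independently of `i`.
        powers : S ^ i * S ^ j ≈ (a * b) ^ (n ℕ.* ⌊ m /2⌋)
        powers = begin
          S ^ i * S ^ j
            ≈⟨ ^-homo-* S i j ⟨
          S ^ (i ℕ.+ j)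
            ≡⟨ ≡.cong (S ^_) (ℕ.m+[n∸m]≡n i≤n) ⟩
          S ^ n
            ≈⟨ ^-assocʳ (a * b) ⌊ m /2⌋ n ⟩
          (a * b) ^ (⌊ m /2⌋ ℕ.* n)
            ≡⟨ ≡.cong ((a * b) ^_) (ℕ.*-comm ⌊ m /2⌋ n) ⟩
          (a * b) ^ (n ℕ.* ⌊ m /2⌋) ∎

      -- `q` and `t` are parameters so that real division and the integer powers in `δ` can be
      -- supplied from outside.
      subsequence-sum : u 0 ≈ 0# → u 1 ≈ 1# → SatisfiesRecurrence u →
        ∀ {w} → SatisfiesRecurrence w → ∀ k n r →
        let N = suc k ℕ.* n ℕ.+ r in
        ∀ q → (a * b) ^ ⌊ N /2⌋ * q ≈ 1# →
        ∀ (t : ℕ → Carrier) → (∀ i → summand w k n r i ≈ t i) →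
        w N ≈ a ^ (1 ℕ.∸ ζ N) * q * Σ≤ n (λ i → (n C i) · t i)
      subsequence-sum u-0 u-1 u-rec {w} w-rec k n r q p*q≈1 t summand≈t =
        trans (unscale N (w N) q p*q≈1) (*-congˡ (begin
          x N
            ≈⟨ binomial-shift (y m) (a * b * c * y k) x m
                 (addition-formula (a * b) (a * b * c) x y
                   (scaled-recurrence w-rec) (scaled-recurrence u-rec) y-0 y-1 k) n r ⟩
          Σ≤ n (term (y m) (a * b * c * y k) n (λ i → x (i ℕ.+ r)))
            ≈⟨ Σ≤-cong n (λ i i≤n → ×-congʳ (n C i)
                 (trans (scaled-summand w k n r i i≤n) (summand≈t i))) ⟩
          Σ≤ n (λ i → (n C i) · t i) ∎))
        where
        m N : ℕ
        m = suc k
        N = m ℕ.* n ℕ.+ r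

        x y : ℕ → Carrier
        x i = scale i * w i
        y i = scale i * u i

        y-0 : y 0 ≈ 0#
        y-0 = trans (*-congˡ u-0) (zeroʳ (scale 0))

        y-1 : y 1 ≈ 1#
        y-1 = trans (*-congˡ u-1) (solve 0 (con 1 :* con 1 :* con 1 := con 1) refl)

-- Specialisation to the real numbers

open import Defs
open CommutativeRing +-*-commutativeRing
  using (commutativeSemiring; *-comm; *-identityˡ; *-identityʳ;
         *-congˡ; *-congʳ; +-congʳ; reflexive)
  renaming (refl to ≈-refl; sym to ≈-sym; trans to ≈-trans)

χ-2+ : ∀ a b n → χ a b (2 ℕ.+ n) ≈ χ a b n
χ-2+ a b n with parity n
... | 0ℙ = ≈-refl
... | 1ℙ = ≈-refl

-- Split on the parity of `n` and on `k = 0`, since the integer exponent computes only once its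
-- signs are known.
^ᶻ-δ-exponent : ∀ x {{_ : NonZero x}} k n →
  x ^ᶻ (ℤ.- (+ k) ℤ.- 1ℤ ℤ.+ + ζ n) ≈ (x ⁻¹) ^ k * (x ⁻¹) ^ (1 ℕ.∸ ζ n)
^ᶻ-δ-exponent x k n with parity n
^ᶻ-δ-exponent x zero n | 0ℙ = ≈-sym (*-identityˡ _)
^ᶻ-δ-exponent x (suc k) n | 0ℙ = ≈-trans
  -- Adding the two negative integers leaves `k + 0` in the exponent.
  (reflexive (≡.cong (λ j → (x ⁻¹) ^ suc (suc j)) (ℕ.+-identityʳ k)))
  (≈-trans (*-comm (x ⁻¹) ((x ⁻¹) ^ suc k)) (*-congˡ (≈-sym (*-identityʳ (x ⁻¹)))))
^ᶻ-δ-exponent x zero n | 1ℙ = ≈-sym (*-identityˡ _)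
^ᶻ-δ-exponent x (suc k) n | 1ℙ = ≈-trans
  (reflexive (≡.cong (λ j → (x ⁻¹) ^ suc j) (ℕ.+-identityʳ k)))
  (≈-sym (*-identityʳ ((x ⁻¹) ^ suc k)))

module _ (a b c : ℝ) {{_ : NonZero a}} {{_ : NonZero b}} where

  open BiPeriodic a b c
  open Rescaling commutativeSemiring a b c (a ⁻¹) (*-inverseʳ a)
    (χ a b) ≈-refl ≈-refl (χ-2+ a b)

  -- `BiPeriodic` takes the coefficient at `2 + n`, `Rescaling` at `n`; the period 2 of `χ`
  -- reconciles them.
  recurrence : ∀ w → (∀ n → w (2 ℕ.+ n) ≈ χ a b (2 ℕ.+ n) * w (suc n) + c * w n) →
    SatisfiesRecurrence w
  recurrence w w-rec n = ≈-trans (w-rec n) (+-congʳ (*-congʳ (χ-2+ a b n)))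

  summand-δ : ∀ (w : ℕ → ℝ) k n r i →
    summand u w k n r i ≈
    c ^ (n ℕ.∸ i) * u (suc k) ^ i * u k ^ (n ℕ.∸ i) * w (i ℕ.+ r) * δ (suc k) n r i
  summand-δ w k n r i = *-congˡ (*-congʳ (*-congˡ
    (≈-sym (^ᶻ-δ-exponent a (ζ (suc k ℕ.+ 1) ℕ.* i) (i ℕ.+ r)))))

  -- Stated for any solution `w` of the recurrence, so that `u` and `v` are two instances.
  bi-periodic-subsequence-sum : ∀ w →
    (∀ n → w (2 ℕ.+ n) ≈ χ a b (2 ℕ.+ n) * w (suc n) + c * w n) →
    ∀ k n r → let m = suc k; N = m ℕ.* n ℕ.+ r in
    w N ≈
      (a ^ (1 ℕ.∸ ζ N) / (a * b) ^ ⌊ N /2⌋) {{^-nonZero (a * b) ⌊ N /2⌋}}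
      * (Σ[ i ≤ n ] ((n C i) · (c ^ (n ℕ.∸ i) * u m ^ i * u k ^ (n ℕ.∸ i)
                                * w (i ℕ.+ r) * δ m n r i)))
  bi-periodic-subsequence-sum w w-rec k n r =
    -- The initial values and the recurrence of `u` hold by its defining clauses.
    subsequence-sum u ≈-refl ≈-refl (recurrence u λ _ → ≈-refl) {w} (recurrence w w-rec)
      k n r ((p ⁻¹) {{p≉0}}) (*-inverseʳ p {{p≉0}})
      (λ i → c ^ (n ℕ.∸ i) * u (suc k) ^ i * u k ^ (n ℕ.∸ i) * w (i ℕ.+ r) * δ (suc k) n r i)
      (summand-δ w k n r)
    where
    p = (a * b) ^ ⌊ suc k ℕ.* n ℕ.+ r /2⌋
    p≉0 = ^-nonZero (a * b) ⌊ suc k ℕ.* n ℕ.+ r /2⌋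

theorem2 : (a b c : ℝ) {{_ : NonZero a}} {{_ : NonZero b}} {{_ : NonZero c}} →
    let open BiPeriodic a b c in
    (n r m : ℕ) → m ℕ.> 1 →
    (u (m ℕ.* n ℕ.+ r) ≈
    (a ^ (1 ℕ.∸ ζ (m ℕ.* n ℕ.+ r)) / (a * b) ^ ⌊ m ℕ.* n ℕ.+ r /2⌋)
    {{^-nonZero (a * b) ⌊ m ℕ.* n ℕ.+ r /2⌋}}
    * (Σ[ i ≤ n ] ((n C i) · (c ^ (n ℕ.∸ i) * u m ^ i * u (m ℕ.∸ 1) ^ (n ℕ.∸ i)
    * u (i ℕ.+ r) * δ m n r i))))
    ×
    (v (m ℕ.* n ℕ.+ r) ≈
    (a ^ (1 ℕ.∸ ζ (m ℕ.* n ℕ.+ r)) / (a * b) ^ ⌊ m ℕ.* n ℕ.+ r /2⌋)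
    {{^-nonZero (a * b) ⌊ m ℕ.* n ℕ.+ r /2⌋}}
    * (Σ[ i ≤ n ] ((n C i) · (c ^ (n ℕ.∸ i) * u m ^ i * u (m ℕ.∸ 1) ^ (n ℕ.∸ i)
    * v (i ℕ.+ r) * δ m n r i))))
-- `m > 1` excludes `m = 0`, so this clause is exhaustive, and `suc k ∸ 1` computes to `k`.
theorem2 a b c n r (suc k) _ =
  bi-periodic-subsequence-sum a b c u (λ _ → ≈-refl) k n r ,
  bi-periodic-subsequence-sum a b c v (λ _ → ≈-refl) k n r
  where open BiPeriodic a b c using (u; v)
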